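{- Let $\mathcal{G}$ be a minor-closed class of graphs with bounded treedepth. Then $$\chi_{\Delta}(\mathcal{G}) = \chi_{\star}(\mathcal{G}) = \operatorname{tcn}(\mathcal{G}) - 1.$$
   Context: All graphs are finite and simple. A $k$-colouring of a graph $G$ is any function assigning one of $k$ colours to each vertex; it need not be proper. A monochromatic component is a connected component of the subgraph induced by all vertices of one colour. A colouring has defect $d$ if every monochromatic component has maximum degree at most $d$. A colouring has clustering $c$ if every monochromatic component has at most $c$ vertices. For a graph class $\mathcal{G}$: - The defective chromatic number $\chi_{\Delta}(\mathcal{G})$ is the minimum integer $k$ such that, for some integer $d$, every graph in $\mathcal{G}$ is $k$-colourable with defect $d$. - The clustered chromatic number $\chi_{\star}(\mathcal{G})$ is the minimum integer $k$ such that, for some integer $c$, every graph in $\mathcal{G}$ is $k$-colourable with clustering $c$. Rooted trees. The depth of a rooted tree is the maximum number of vertices on a root-to-leaf path. The closure of a rooted tree $T$ is obtained from $T$ by adding an edge between every vertex and each of its descendants. For $h,k\ge 1$, $C\langle h,k\rangle$ denotes the closure of the complete $k$-ary tree of depth $h$. The tree-closure-number is $\operatorname{tcn}(\mathcal{G}) := \min\{h : \exists k\ C\langle h,k\rangle \notin \mathcal{G}\}$. Treedepth. The connected treedepth of a graph $H$ is the minimum depth of a rooted tree $T$ such that $H$ is a subgraph of the closure of $T$. The treedepth of $H$ is the maximum connected treedepth over the connected components of $H$. A class has bounded treedepth if some constant bounds the treedepth of every graph in it. Minors. A class $\mathcal{G}$ is minor-closed if every minor of every graph in $\mathcal{G}$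 (up to isomorphism) is in $\mathcal{G}$. -}

module Defs where

open import Data.Nat using (ℕ; zero; suc; _*_; _≤_; _∸_)
open import Data.Fin using (Fin; zero; suc; remQuot; _≟_)
open import Data.Bool using (Bool; true; false; _∧_)
open import Data.Bool.Properties using (∧-comm)
open import Data.Maybe using (Maybe; just)
open import Data.Product using (Σ; ∃; _×_; _,_; proj₁; proj₂)
open import Data.Empty using (⊥)
open import Relation.Nullary using (¬_; yes; no)
open import Relation.Nullary.Decidable using (⌊_⌋)
open import Relation.Binary.PropositionalEquality using (_≡_; refl; sym; cong; cong₂)
open import Function.Definitions using (Injective)

record Graph : Set where
  field
    n      : ℕ
    adj    : Fin n → Fin n → Bool
    symm   : ∀ u v → adj u v ≡ adj v u
    irrefl : ∀ v → adj v v ≡ false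
open Graph public

V : Graph → Set
V G = Fin (n G)

Adj : (G : Graph) → V G → V G → Set
Adj G u v = adj G u v ≡ true

data Reach (G : Graph) (P : V G → Set) : V G → V G → Set where
  here : ∀ {u} → P u → Reach G P u u
  step : ∀ {u v w} → P u → Adj G u v → Reach G P v w → Reach G P u w

AtMost : (G : Graph) → ℕ → (V G → Set) → Set
AtMost G m Q = ¬ (Σ (Fin (suc m) → V G) λ f → Injective _≡_ _≡_ f × (∀ i → Q (f i)))

-- Minors (via branch-set models): β assigns some vertices of G to
-- vertices of H; branch sets are nonempty, connected in G, and every
-- edge of H is realised by an edge of G between the branch sets.

Minor : Graph → Graph → Set
Minor H G =
  Σ (V G → Maybe (V H)) λ β →
      (∀ x → ∃ λ u → β u ≡ just x)
    × (∀ x u u' → β u ≡ just x → β u' ≡ just x → Reach G (λ w → β w ≡ just x) u u')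
    × (∀ x y → Adj H x y → ∃ λ u → ∃ λ u' → β u ≡ just x × β u' ≡ just y × Adj G u u')

GraphClass : Set₁
GraphClass = Graph → Set

MinorClosed : GraphClass → Set
MinorClosed 𝒢 = ∀ G H → 𝒢 G → Minor H G → 𝒢 H

Colouring : Graph → ℕ → Set
Colouring G k = V G → Fin k

-- every monochromatic component has maximum degree ≤ d: the degree of v
-- in its monochromatic component is the number of neighbours of v of
-- the same colour as v.
HasDefect : (G : Graph) {k : ℕ} → Colouring G k → ℕ → Set
HasDefect G col d = ∀ v → AtMost G d (λ w → Adj G v w × col w ≡ col v)

HasClustering : (G : Graph) {k : ℕ} → Colouring G k → ℕ → Set
HasClustering G col c = ∀ v → AtMost G c (λ w → Reach G (λ x → col x ≡ col v) v w)

DefectivelyColourable : GraphClass → ℕ → Set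
DefectivelyColourable 𝒢 k =
  ∃ λ d → ∀ G → 𝒢 G → Σ (Colouring G k) λ col → HasDefect G col d

ClusteredColourable : GraphClass → ℕ → Set
ClusteredColourable 𝒢 k =
  ∃ λ c → ∀ G → 𝒢 G → Σ (Colouring G k) λ col → HasClustering G col c

IsMinimum : (ℕ → Set) → ℕ → Set
IsMinimum P m = P m × (∀ j → P j → m ≤ j)

DefectiveChromaticNumberIs : GraphClass → ℕ → Set
DefectiveChromaticNumberIs 𝒢 = IsMinimum (DefectivelyColourable 𝒢)

ClusteredChromaticNumberIs : GraphClass → ℕ → Set
ClusteredChromaticNumberIs 𝒢 = IsMinimum (ClusteredColourable 𝒢)

data Tree : Set where
  node : (m : ℕ) → (Fin m → Tree) → Tree

maxF : (m : ℕ) → (Fin m → ℕ) → ℕ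
maxF zero    f = 0
maxF (suc m) f = Data.Nat._⊔_ (f zero) (maxF m (λ i → f (suc i)))

depth : Tree → ℕ
depth (node m ch) = suc (maxF m (λ i → depth (ch i)))

data Pos : Tree → Set where
  root : ∀ {t} → Pos t
  sub  : ∀ {m ch} (i : Fin m) → Pos (ch i) → Pos (node m ch)

data _≺_ : {t : Tree} → Pos t → Pos t → Set where
  root≺ : ∀ {m ch} {i : Fin m} {q : Pos (ch i)} → root ≺ sub {m} {ch} i q
  sub≺  : ∀ {m ch} {i : Fin m} {p q : Pos (ch i)} → p ≺ q → sub {m} {ch} i p ≺ sub i q

ClosureAdj : {t : Tree} → Pos t → Pos t → Set
ClosureAdj p q = (p ≺ q) Data.Sum.⊎ (q ≺ p)
  where import Data.Sum

ComponentTreedepth≤ : (G : Graph) → V G → ℕ → Set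
ComponentTreedepth≤ G v c =
  Σ Tree λ T → depth T ≤ c ×
  Σ ((Σ (V G) λ w → Reach G (λ _ → Data.Unit.⊤) v w) → Pos T) λ f →
      (∀ a b → f a ≡ f b → proj₁ a ≡ proj₁ b)
    × (∀ a b → Adj G (proj₁ a) (proj₁ b) → ClosureAdj (f a) (f b))
  where import Data.Unit

Treedepth≤ : Graph → ℕ → Set
Treedepth≤ G c = ∀ v → ComponentTreedepth≤ G v c

BoundedTreedepth : GraphClass → Set
BoundedTreedepth 𝒢 = ∃ λ c → ∀ G → 𝒢 G → Treedepth≤ G c

-- C⟨h,k⟩ : closure of the complete k-ary tree of depth h, built
-- recursively: C⟨1,k⟩ = K₁, and C⟨h+1,k⟩ is a root vertex adjacent to
-- all vertices of k disjoint copies of C⟨h,k⟩ (C⟨0,k⟩ is the empty graph).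

-- k disjoint copies of G; vertex combine i x = vertex x of copy i
copies : ℕ → Graph → Graph
copies k G = record
  { n = k * n G
  ; adj = λ u v → ⌊ proj₁ (rq u) ≟ proj₁ (rq v) ⌋ ∧ adj G (proj₂ (rq u)) (proj₂ (rq v))
  ; symm = λ u v → cong₂ _∧_ (eqsym (proj₁ (rq u)) (proj₁ (rq v))) (symm G _ _)
  ; irrefl = λ u → helper (proj₁ (rq u)) (irrefl G (proj₂ (rq u)))
  }
  where
  rq : Fin (k * n G) → Fin k × Fin (n G)
  rq = remQuot (n G)
  eqsym : (a b : Fin k) → ⌊ a ≟ b ⌋ ≡ ⌊ b ≟ a ⌋
  eqsym a b with a ≟ b | b ≟ a
  ... | yes _ | yes _ = refl
  ... | no _  | no _  = refl
  ... | yes p | no q  = Data.Empty.⊥-elim (q (sym p))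
    where import Data.Empty
  ... | no p  | yes q = Data.Empty.⊥-elim (p (sym q))
    where import Data.Empty
  helper : ∀ (a : Fin k) {x : Fin (n G)} → adj G x x ≡ false → ⌊ a ≟ a ⌋ ∧ adj G x x ≡ false
  helper a e with a ≟ a
  ... | yes _ = e
  ... | no _  = refl

apex : Graph → Graph
apex G = record
  { n = suc (n G)
  ; adj = a
  ; symm = s
  ; irrefl = ir
  }
  where
  a : Fin (suc (n G)) → Fin (suc (n G)) → Bool
  a zero    zero    = false
  a zero    (suc _) = true
  a (suc _) zero    = true
  a (suc u) (suc v) = adj G u v
  s : ∀ u v → a u v ≡ a v u
  s zero zero = refl
  s zero (suc _) = refl
  s (suc _) zero = refl
  s (suc u) (suc v) = symm G u v
  ir : ∀ v → a v v ≡ false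
  ir zero = refl
  ir (suc v) = irrefl G v

emptyGraph : Graph
emptyGraph = record { n = 0 ; adj = λ () ; symm = λ () ; irrefl = λ () }

C⟨_,_⟩ : ℕ → ℕ → Graph
C⟨ zero  , k ⟩ = emptyGraph
C⟨ suc h , k ⟩ = apex (copies k C⟨ h , k ⟩)

TcnCandidate : GraphClass → ℕ → Set
TcnCandidate 𝒢 h = 1 ≤ h × ∃ λ k → 1 ≤ k × ¬ 𝒢 C⟨ h , k ⟩

TcnIs : GraphClass → ℕ → Set
TcnIs 𝒢 = IsMinimum (TcnCandidate 𝒢)

module Submission where

{-
Upper bound.  Let k = t - 1 and C⟨t, b⟩ ∉ 𝒢.  Every component has an elimination tree of bounded depth all
of whose subtrees are connected.  Call a child of a node heavy if, for every set S of its ancestors and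
s = k - |S|, whenever its subtree contains a (b + 1)-branching weak closure of depth s + 1 attached to all
of S, so do the subtrees of at least b + 1 of its siblings (itself included).  Only boundedly many
children of a node are light, so cutting the tree at the heavy children leaves chunks of bounded size.
Colour the chunks from the root downwards, giving each a colour not used by the chunks above that its
subtree sees.  If a chunk sees all k colours, choose one ancestor of each colour; they lie in different
chunks, and heaviness turns this chain, from the bottom upwards, into a weak closure of depth k + 1,
which contains C⟨k + 1, b⟩ as a minor.

Lower bound.  In a colouring of C⟨h, k⟩ in which no vertex has k neighbours of its own colour, some copy of
C⟨h - 1, k⟩ below the root avoids the colour of the root; by induction h colours occur.
-}

open import Defs
open import Data.Bool using (true; _∧_)
open import Data.Bool.Properties using () renaming (_≟_ to _≟ᵇ_)
open import Data.Empty using (⊥; ⊥-elim)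
open import Data.Fin using (Fin; zero; suc; combine; _≟_; inject≤; fromℕ<)
open import Data.Fin.Properties
  using (any?; all?; injective⇒≤; ¬∀⟶∃¬; inject≤-injective; remQuot-combine; combine-remQuot;
    combine-injective; suc-injective; fromℕ<-injective)
open import Data.List
  using (List; []; _∷_; length; map; filter; allFin; lookup; cartesianProduct; _++_)
open import Data.List.Membership.Propositional using (_∈_)
open import Data.List.Membership.Propositional.Properties
  using (∈-filter⁺; ∈-filter⁻; ∈-allFin; ∈-lookup; ∈-cartesianProduct⁺; ∈-++⁺ˡ; ∈-++⁺ʳ; ∈-map⁺)
open import Data.List.Membership.Setoid.Properties using (index-injective)
open import Data.List.Properties using (length-++; length-map)
open import Data.List.Relation.Binary.Sublist.Propositional using (_⊆_; []; _∷ʳ_; _∷_; minimum)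
open import Data.List.Relation.Unary.All using (All; []; _∷_)
open import Data.List.Relation.Unary.AllPairs using ([]; _∷_)
open import Data.List.Relation.Unary.Any using (index)
open import Data.List.Relation.Unary.Any.Properties using (lookup-index)
open import Data.List.Relation.Unary.Unique.Propositional using (Unique)
open import Data.List.Relation.Unary.Unique.Propositional.Properties using (allFin⁺; filter⁺)
open import Data.Maybe using (Maybe; just; nothing)
open import Data.Nat using (ℕ; zero; suc; _∸_; _+_; _*_; _^_; _≤_; _<_; z≤n; s≤s; _≤?_; pred)
open import Data.Nat.Induction using (<-rec)
open import Data.Nat.Properties
  using (≤-refl; ≤-trans; ≤-reflexive; +-mono-≤; m≤m⊔n; m≤n⊔m; ≰⇒>; <⇒≱; *-monoˡ-≤; n≤1+n;
    ≤-antisym; +-suc; +-identityʳ; m+n∸m≡n; m≤m+n; *-identityˡ; <⇒≤; m≤n+m)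
open import Data.Product using (Σ; ∃; _×_; _,_; proj₁; proj₂)
open import Data.Sum using (_⊎_; inj₁; inj₂; [_,_]′)
open import Data.Unit using (⊤; tt)
open import Relation.Binary.PropositionalEquality
  using (_≡_; _≢_; refl; sym; trans; cong; cong₂; subst; subst₂)
open import Relation.Binary.PropositionalEquality.Properties using (setoid)
open import Relation.Nullary using (¬_; Dec; yes; no; contradiction)
open import Relation.Nullary.Decidable using (_×-dec_; map′; _⊎-dec_; ⌊_⌋; ¬?; decidable-stable)
open import Function.Definitions using (Injective)
import Data.List.Membership.DecPropositional as DecMembership
import Data.List.Relation.Unary.All as All
import Data.List.Relation.Unary.All.Properties as All
import Data.List.Relation.Unary.Any as Any
import Data.Maybe as Maybe

-- Counting in finite sets; light and heavy indices.

unique-lookup-injective : ∀ {A : Set} {xs : List A} → Unique xs → Injective _≡_ _≡_ (lookup xs)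
unique-lookup-injective {xs = _ ∷ _} (_ ∷ _) {zero} {zero} _ = refl
unique-lookup-injective {xs = _ ∷ xs} (x∉ ∷ _) {zero} {suc j} eq =
  contradiction eq (All.lookup x∉ (∈-lookup j))
unique-lookup-injective {xs = _ ∷ xs} (x∉ ∷ _) {suc i} {zero} eq =
  contradiction (sym eq) (All.lookup x∉ (∈-lookup i))
unique-lookup-injective {xs = _ ∷ _} (_ ∷ u) {suc i} {suc j} eq =
  cong suc (unique-lookup-injective u eq)

injection-into-list : ∀ {A : Set} {m} {f : Fin m → A} → Injective _≡_ _≡_ f →
  (xs : List A) → (∀ i → f i ∈ xs) → m ≤ length xs
injection-into-list inj xs f∈ = injective⇒≤ {f = λ i → index (f∈ i)}
  (λ {i} {j} eq → inj (index-injective (setoid _) (f∈ i) (f∈ j) eq))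

Many : ∀ {m} → ℕ → (Fin m → Set) → Set
Many {m} K R = Σ (Fin K → Fin m) λ f → Injective _≡_ _≡_ f × (∀ i → R (f i))

module _ {m} {R : Fin m → Set} (R? : ∀ i → Dec (R i)) where

  witnesses : List (Fin m)
  witnesses = filter R? (allFin m)

  ∈-witnesses : ∀ {i} → R i → i ∈ witnesses
  ∈-witnesses {i} r = ∈-filter⁺ R? (∈-allFin i) r

  witness-lookup : ∀ j → R (lookup witnesses j)
  witness-lookup j = proj₂ (∈-filter⁻ R? {xs = allFin m} (∈-lookup j))

  witness-injective : Injective _≡_ _≡_ (lookup witnesses)
  witness-injective = unique-lookup-injective (filter⁺ R? (allFin⁺ m))

  many-or-few : ∀ K → Many K R ⊎ length witnesses < K
  many-or-few K with K ≤? length witnesses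
  ... | yes K≤ = inj₁ ((λ i → lookup witnesses (inject≤ i K≤))
                     , (λ eq → inject≤-injective K≤ K≤ _ _ (witness-injective eq))
                     , (λ i → witness-lookup (inject≤ i K≤)))
  ... | no K≰ = inj₂ (≰⇒> K≰)

  many? : ∀ K → Dec (Many K R)
  many? K with many-or-few K
  ... | inj₁ many = yes many
  ... | inj₂ few = no λ (f , inj , r) → <⇒≱ few (injection-into-list inj witnesses (λ i → ∈-witnesses (r i)))

-- An `a` with fewer than `K` witnesses puts all of them into `L`; any other `a` puts in none, since
-- `Many K (R a)` then holds outright.
light-or-heavy : ∀ {A : Set} {m} (K : ℕ) (R : A → Fin m → Set) → (∀ a i → Dec (R a i)) → (as : List A) →
  Σ (List (Fin m)) λ L → length L ≤ length as * K ×
    (∀ i → i ∈ L ⊎ (∀ {a} → a ∈ as → R a i → Many K (R a)))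
light-or-heavy K R R? [] = [] , z≤n , λ i → inj₂ λ ()
light-or-heavy K R R? (a ∷ as) with light-or-heavy K R R? as | many-or-few (R? a) K
... | L , len , split | inj₁ many = L , ≤-trans len (m≤n+m _ K) , λ i →
  [ inj₁ , (λ heavy → inj₂ λ { (Any.here refl) _ → many ; (Any.there a∈) r → heavy a∈ r }) ]′ (split i)
... | L , len , split | inj₂ few =
  L′ ++ L
  , ≤-trans (≤-reflexive (length-++ L′)) (+-mono-≤ (<⇒≤ few) len)
  , classify
  where
  L′ = witnesses (R? a)
  classify : ∀ i → i ∈ L′ ++ L ⊎ (∀ {b} → b ∈ a ∷ as → R b i → Many K (R b))
  classify i with R? a i | split i
  ... | yes r | _ = inj₁ (∈-++⁺ˡ (∈-witnesses (R? a) r))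
  ... | no _ | inj₁ i∈ = inj₁ (∈-++⁺ʳ L′ i∈)
  ... | no ¬r | inj₂ heavy = inj₂ λ { (Any.here refl) r → contradiction r ¬r ; (Any.there b∈) r → heavy b∈ r }

-- Reachability and connected components.

module _ {G : Graph} where

  reach-map : ∀ {P Q : V G → Set} → (∀ {w} → P w → Q w) → ∀ {u v} → Reach G P u v → Reach G Q u v
  reach-map f (here p) = here (f p)
  reach-map f (step p a r) = step (f p) a (reach-map f r)

  reach-trans : ∀ {P u v w} → Reach G P u v → Reach G P v w → Reach G P u w
  reach-trans (here _) s = s
  reach-trans (step p a r) s = step p a (reach-trans r s)

  reach-source : ∀ {P u v} → Reach G P u v → P u
  reach-source (here p) = p
  reach-source (step p _ _) = p

  reach-target : ∀ {P u v} → Reach G P u v → P v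
  reach-target (here p) = p
  reach-target (step _ _ r) = reach-target r

  adj-sym : ∀ {u v} → Adj G u v → Adj G v u
  adj-sym {u} {v} a = trans (symm G v u) a

  reach-sym : ∀ {P u v} → Reach G P u v → Reach G P v u
  reach-sym (here p) = here p
  reach-sym (step p a r) =
    reach-trans (reach-sym r) (step (reach-source r) (adj-sym a) (here p))

  adj? : ∀ u v → Dec (Adj G u v)
  adj? u v = adj G u v ≟ᵇ true

  Connected : (V G → Set) → Set
  Connected P = ∀ {u v} → P u → P v → Reach G P u v

  -- Union–find: components are obtained by merging labels along a list of edges, which decides
  -- reachability without bounding the length of paths.
  record Labelling (P : V G → Set) (es : List (V G × V G)) : Set where
    field
      label      : V G → V G
      connects   : ∀ {u} → P u → Reach G P u (label u)
      idempotent : ∀ u → label (label u) ≡ label u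
      respects   : ∀ {u v} → (u , v) ∈ es → P u → P v → Adj G u v → label u ≡ label v

    same-label⇒reach : ∀ {u v} → P u → P v → label u ≡ label v → Reach G P u v
    same-label⇒reach {u} {v} p q eq =
      reach-trans (subst (Reach G P u) eq (connects p)) (reach-sym (connects q))

    label-∈ : ∀ {u} → P u → P (label u)
    label-∈ p = reach-target (connects p)

  module _ {P : V G → Set} (P? : ∀ v → Dec (P v)) where
    open Labelling

    trivial-labelling : Labelling P []
    trivial-labelling = record
      { label = λ u → u ; connects = here ; idempotent = λ _ → refl ; respects = λ () }

    -- The whole class of `a` is relabelled with the representative of `b`; its vertices reach that
    -- representative through the edge from `a` to `b`.
    merge : ∀ {es} a b → P a → P b → Adj G a b → Labelling P es → Labelling P ((a , b) ∷ es)
    merge {es} a b pa pb a~b L = record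
      { label = l′ ; connects = connects′ ; idempotent = idem′ ; respects = respects′ }
      where
      l : V G → V G
      l = label L
      l′ : V G → V G
      l′ u with l u ≟ l a
      ... | yes _ = l b
      ... | no _  = l u
      connects′ : ∀ {u} → P u → Reach G P u (l′ u)
      connects′ {u} p with l u ≟ l a
      ... | yes eq = reach-trans (same-label⇒reach L p pa eq) (step pa a~b (connects L pb))
      ... | no _   = connects L p
      l′-of-representative : ∀ u → l (l u) ≡ l u → l u ≢ l a → l′ (l u) ≡ l u
      l′-of-representative u eq neq with l (l u) ≟ l a
      ... | yes eq′ = contradiction (trans (sym eq) eq′) neq
      ... | no _    = eq
      l′-of-lb : l′ (l b) ≡ l b
      l′-of-lb with l (l b) ≟ l a
      ... | yes _ = refl
      ... | no _  = idempotent L b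
      idem′ : ∀ u → l′ (l′ u) ≡ l′ u
      idem′ u with l u ≟ l a
      ... | yes _  = l′-of-lb
      ... | no neq = l′-of-representative u (idempotent L u) neq
      l′-cong : ∀ {u v} → l u ≡ l v → l′ u ≡ l′ v
      l′-cong {u} {v} eq with l u ≟ l a | l v ≟ l a
      ... | yes _ | yes _ = refl
      ... | yes p | no q  = contradiction (trans (sym eq) p) q
      ... | no p  | yes q = contradiction (trans eq q) p
      ... | no _  | no _  = eq
      l′-a≡l′-b : l′ a ≡ l′ b
      l′-a≡l′-b with l a ≟ l a | l b ≟ l a
      ... | yes _  | yes _ = refl
      ... | yes _  | no _  = refl
      ... | no neq | _     = contradiction refl neq
      respects′ : ∀ {u v} → (u , v) ∈ (a , b) ∷ es → P u → P v → Adj G u v → l′ u ≡ l′ v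
      respects′ (Any.here refl) _ _ _ = l′-a≡l′-b
      respects′ (Any.there e∈) p q u~v = l′-cong (respects L e∈ p q u~v)

    labelling : ∀ es → Labelling P es
    labelling [] = trivial-labelling
    labelling ((a , b) ∷ es) with P? a ×-dec P? b ×-dec adj? a b
    ... | yes (pa , pb , a~b) = merge a b pa pb a~b (labelling es)
    ... | no none = record
      { label = label L ; connects = connects L ; idempotent = idempotent L ; respects = respects′ }
      where
      L : Labelling P es
      L = labelling es
      respects′ : ∀ {u v} → (u , v) ∈ (a , b) ∷ es → P u → P v → Adj G u v → label L u ≡ label L v
      respects′ (Any.here refl) p q u~v = contradiction (p , q , u~v) none
      respects′ (Any.there e∈) = respects L e∈

    allEdges : List (V G × V G)
    allEdges = cartesianProduct (allFin (n G)) (allFin (n G))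

    components : Labelling P allEdges
    components = labelling allEdges

    components-respect : ∀ {u v} → P u → P v → Adj G u v → label components u ≡ label components v
    components-respect {u} {v} =
      respects components (∈-cartesianProduct⁺ (∈-allFin u) (∈-allFin v))

-- Vertices and edges of disjoint copies.

pair-adjacent : ∀ {k} (H : Graph) → Fin k × V H → Fin k × V H → Set
pair-adjacent H p q = ⌊ proj₁ p ≟ proj₁ q ⌋ ∧ adj H (proj₂ p) (proj₂ q) ≡ true

copies-adjacent⁻ : ∀ {k H} {i j : Fin k} {x y : V H} →
  Adj (copies k H) (combine i x) (combine j y) → i ≡ j × Adj H x y
copies-adjacent⁻ {k} {H} {i} {j} {x} {y} x~y
  with i ≟ j | subst₂ (pair-adjacent H) (remQuot-combine {k} i x) (remQuot-combine {k} j y) x~y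
... | yes i≡j | x~y′ = i≡j , x~y′

copies-adjacent⁺ : ∀ {k H} (i : Fin k) {x y : V H} → Adj H x y →
  Adj (copies k H) (combine i x) (combine i y)
copies-adjacent⁺ {k} {H} i {x} {y} x~y =
  subst₂ (pair-adjacent H) (sym (remQuot-combine {k} i x)) (sym (remQuot-combine {k} i y)) same
  where
  same : pair-adjacent H (i , x) (i , y)
  same with i ≟ i
  ... | yes _  = x~y
  ... | no neq = contradiction refl neq

data CopiesVertex (k : ℕ) (H : Graph) : V (copies k H) → Set where
  copy-vertex : (i : Fin k) (x : V H) → CopiesVertex k H (combine i x)

copies-vertex : ∀ {k H} z → CopiesVertex k H z
copies-vertex {k} {H} z = subst (CopiesVertex k H) (combine-remQuot {k} (n H) z) (copy-vertex _ _)

-- Elimination trees and rich subtrees.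

-- The index is only an upper bound on the depth: a leaf may have any index `suc d`.
data ETree (A : Set) : ℕ → Set where
  branch : ∀ {d} → A → (m : ℕ) → (Fin m → ETree A d) → ETree A (suc d)

module _ {A : Set} where

  top : ∀ {d} → ETree A d → A
  top (branch r _ _) = r

  arity : ∀ {d} → ETree A d → ℕ
  arity (branch _ m _) = m

  child : ∀ {d} (t : ETree A d) → Fin (arity t) → ETree A (pred d)
  child (branch _ _ ch) = ch

  data Some (P : ∀ {d} → ETree A d → Set) {d} (t : ETree A d) : Set where
    at    : P t → Some P t
    below : ∀ i → Some P (child t i) → Some P t

  some? : ∀ {P : ∀ {d} → ETree A d → Set} → (∀ {d} (t : ETree A d) → Dec (P t)) →
    ∀ {d} (t : ETree A d) → Dec (Some P t)
  some? P? t@(branch _ _ ch) = map′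
    (λ { (inj₁ p) → at p ; (inj₂ (i , s)) → below i s })
    (λ { (at p) → inj₁ p ; (below i s) → inj₂ (i , s) })
    (P? t ⊎-dec any? (λ i → some? P? (ch i)))

  infix 4 _∈ₜ_
  _∈ₜ_ : A → ∀ {d} → ETree A d → Set
  v ∈ₜ t = Some (λ s → v ≡ top s) t

module _ (G : Graph) where

  -- `separated` confines edges to ancestor-descendant pairs. `connected`, imposed on every subtree
  -- through `children`, lets each subtree serve as a branch set.
  record Elimination {d} (t : ETree (V G) d) : Set where
    inductive
    field
      connected : Connected {G} (_∈ₜ t)
      top∉      : ∀ i → ¬ top t ∈ₜ child t i
      disjoint  : ∀ {i j v} → v ∈ₜ child t i → v ∈ₜ child t j → i ≡ j
      separated : ∀ {i j u v} → u ∈ₜ child t i → v ∈ₜ child t j → Adj G u v → i ≡ j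
      children  : ∀ i → Elimination (child t i)

  Touches : ∀ {d} → ETree (V G) d → V G → Set
  Touches t a = ∃ λ y → y ∈ₜ t × Adj G a y

  _∈ₜ?_ : ∀ v {d} (t : ETree (V G) d) → Dec (v ∈ₜ t)
  v ∈ₜ? t = some? (λ s → v ≟ top s) t

  touches? : ∀ {d} (t : ETree (V G) d) a → Dec (Touches t a)
  touches? t a = any? (λ y → (y ∈ₜ? t) ×-dec adj? {G} a y)

  -- Rich K t S s says that the vertices of t contain a K-branching weak closure of depth s + 1 (only
  -- the leaves see their ancestors), each of whose leaves also sees all of S.
  mutual
    Rich : ℕ → ∀ {d} → ETree (V G) d → List (V G) → ℕ → Set
    Rich K t S zero    = All (Touches t) S
    Rich K t S (suc s) = Some (λ t₁ → Split K t₁ (top t₁ ∷ S) s) t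

    Split : ℕ → ∀ {d} → ETree (V G) d → List (V G) → ℕ → Set
    Split K t S s = Some (λ t₂ → Many K (λ i → Rich K (child t₂ i) S s)) t

  mutual
    rich? : ∀ K {d} (t : ETree (V G) d) S s → Dec (Rich K t S s)
    rich? K t S zero    = All.all? (touches? t) S
    rich? K t S (suc s) = some? (λ t₁ → split? K t₁ (top t₁ ∷ S) s) t

    split? : ∀ K {d} (t : ETree (V G) d) S s → Dec (Split K t S s)
    split? K t S s = some? (λ t₂ → many? (λ i → rich? K (child t₂ i) S s) K) t

  touches-child : ∀ {d} {t : ETree (V G) d} {a} i → Touches (child t i) a → Touches t a
  touches-child i (y , y∈ , a~y) = y , below i y∈ , a~y

  rich-child : ∀ {K d} {t : ETree (V G) d} {S} s i → Rich K (child t i) S s → Rich K t S s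
  rich-child zero    i r = All.map (touches-child i) r
  rich-child (suc s) i r = below i r

  touches-some : ∀ {d} {t : ETree (V G) d} {a} {P : ∀ {e} → ETree (V G) e → Set} →
    (∀ {e} {s : ETree (V G) e} → P s → Touches s a) → Some P t → Touches t a
  touches-some f (at p) = f p
  touches-some f (below i s) = touches-child i (touches-some f s)

  -- The last clause keeps an apex at the top of `t` apart from the branches hanging below a
  -- possibly much deeper node `s`.
  elimination-some : ∀ {d} {t : ETree (V G) d} {P : ∀ {e} → ETree (V G) e → Set} → Elimination t → Some P t →
    Σ ℕ λ e → Σ (ETree (V G) e) λ s → Elimination s × P s ×
      (∀ {v} → v ∈ₜ s → v ∈ₜ t) × (∀ i → ¬ top t ∈ₜ child s i)
  elimination-some E (at p) = _ , _ , E , p , (λ v∈ → v∈) , Elimination.top∉ E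
  elimination-some {t = t} E (below i q) with elimination-some (Elimination.children E i) q
  ... | _ , _ , E′ , p , inside , _ =
    _ , _ , E′ , p , (λ v∈ → below i (inside v∈)) , λ j t∈ → Elimination.top∉ E i (inside (below j t∈))

  -- Following the first branch at every split leads to a leaf, which sees all of `S`; the form
  -- `suc k` ensures that there is a first branch.
  rich⇒touches : ∀ {k d} {t : ETree (V G) d} {S a} s → a ∈ S →
    Rich (suc k) t S s → Touches t a
  rich⇒touches zero a∈ r = All.lookup r a∈
  rich⇒touches (suc s) a∈ r =
    touches-some (touches-some λ { (f , _ , rs) → touches-child (f zero) (rich⇒touches s (Any.there a∈) (rs zero)) }) r

  -- Minor models of tree closures.

  -- A minor model strengthened for induction: `inside` keeps models in different subtrees disjoint,
  -- and `attached` lets any vertex of `S` later become an apex over all branch sets.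
  record Model (H : Graph) (X : V G → Set) (S : List (V G)) : Set where
    field
      β         : V G → Maybe (V H)
      inside    : ∀ {u x} → β u ≡ just x → X u
      nonempty  : ∀ x → ∃ λ u → β u ≡ just x
      connected : ∀ x {u u′} → β u ≡ just x → β u′ ≡ just x → Reach G (λ w → β w ≡ just x) u u′
      edges     : ∀ {x y} → Adj H x y → ∃ λ u → ∃ λ u′ → β u ≡ just x × β u′ ≡ just y × Adj G u u′
      attached  : ∀ x {a} → a ∈ S → ∃ λ u → β u ≡ just x × Adj G a u

  model⇒minor : ∀ {H X S} → Model H X S → Minor H G
  model⇒minor M = β , nonempty , (λ x u u′ → connected x) , (λ x y → edges)
    where open Model M

  -- One set becomes the apex; every other set contributes a copy of H.
  module _ {k : ℕ} {H : Graph} {X : V G → Set} {S : List (V G)} {a : V G}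
    (Y : V G → Set) (Y? : ∀ v → Dec (Y v)) (Yconn : Connected {G} Y) (a∈Y : Y a)
    (Ysees : ∀ {b} → b ∈ S → ∃ λ u → Y u × Adj G b u) (Y⊆X : ∀ {v} → Y v → X v)
    (Z : Fin k → V G → Set) (Z? : ∀ i v → Dec (Z i v)) (Z⊆X : ∀ {i v} → Z i v → X v)
    (Y∩Z : ∀ {i v} → Y v → Z i v → ⊥) (Z∩Z : ∀ {i j v} → Z i v → Z j v → i ≡ j)
    (M : ∀ i → Model H (Z i) (a ∷ S)) where

    private
      module M i = Model (M i)

    β′ : V G → Maybe (V (apex (copies k H)))
    β′ v with Y? v | any? (λ i → Z? i v)
    ... | yes _ | _           = just zero
    ... | no _  | yes (i , _) = Maybe.map (λ y → suc (combine i y)) (M.β i v)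
    ... | no _  | no _        = nothing

    β′-apex : ∀ {v} → Y v → β′ v ≡ just zero
    β′-apex {v} y with Y? v | any? (λ i → Z? i v)
    ... | yes _ | _ = refl
    ... | no ¬y | _ = contradiction y ¬y

    β′-copy : ∀ i {v x} → M.β i v ≡ just x → β′ v ≡ just (suc (combine i x))
    β′-copy i {v} eq with Y? v | any? (λ i → Z? i v)
    ... | yes y | _ = ⊥-elim (Y∩Z y (M.inside i eq))
    ... | no _  | yes (j , z) with Z∩Z z (M.inside i eq)
    ...   | refl rewrite eq = refl
    β′-copy i {v} eq | no _ | no ¬z = contradiction (i , M.inside i eq) ¬z

    data Origin (v : V G) : V (apex (copies k H)) → Set where
      from-apex : Y v → Origin v zero
      from-copy : ∀ i {x} → M.β i v ≡ just x → Origin v (suc (combine i x))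

    origin : ∀ {v x} → β′ v ≡ just x → Origin v x
    origin {v} eq with Y? v | any? (λ i → Z? i v)
    origin refl | yes y | _ = from-apex y
    origin {v} eq | no _ | yes (i , _) with M.β i v in eq′
    origin refl | no _ | yes (i , _) | just x = from-copy i eq′

    data Vertex : V (apex (copies k H)) → Set where
      the-apex : Vertex zero
      copy-of  : (i : Fin k) (x : V H) → Vertex (suc (combine i x))

    vertex-cases : ∀ x → Vertex x
    vertex-cases zero = the-apex
    vertex-cases (suc z) with copies-vertex {k} {H} z
    ... | copy-vertex i x = copy-of i x

    private
      combined-connected : ∀ x {u u′} → Origin u x → Origin u′ x → Reach G (λ w → β′ w ≡ just x) u u′
      combined-connected _ (from-apex y) o with o
      ... | from-apex y′ = reach-map β′-apex (Yconn y y′)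
      combined-connected _ {u} {u′} (from-copy i {x} eq) o = go o refl
        where
        -- The vertex is generalised to `z` because unification cannot invert `combine`.
        go : ∀ {z} → Origin u′ z → z ≡ suc (combine i x) → Reach G (λ w → β′ w ≡ just (suc (combine i x))) u u′
        go (from-copy j {y} eq′) e
          with refl , refl ← combine-injective j y i x (suc-injective e)
          = reach-map (β′-copy i) (M.connected i x eq eq′)

      combined-edges : ∀ {x y} → Vertex x → Vertex y → Adj (apex (copies k H)) x y →
        ∃ λ u → ∃ λ u′ → β′ u ≡ just x × β′ u′ ≡ just y × Adj G u u′
      combined-edges the-apex the-apex ()
      combined-edges the-apex (copy-of i x) _ with M.attached i x (Any.here refl)
      ... | u , eq , a~u = a , u , β′-apex a∈Y , β′-copy i eq , a~u
      combined-edges (copy-of i x) the-apex _ with M.attached i x (Any.here refl)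
      ... | u , eq , a~u = u , a , β′-copy i eq , β′-apex a∈Y , adj-sym {G} a~u
      combined-edges (copy-of i x) (copy-of j y) x~y with copies-adjacent⁻ {k} {H} x~y
      ... | refl , x~y′ with M.edges i x~y′
      ...   | u , u′ , eq , eq′ , u~u′ = u , u′ , β′-copy i eq , β′-copy i eq′ , u~u′

    apex-model : Model (apex (copies k H)) X S
    apex-model = record
      { β = β′
      ; inside = λ eq → inside′ (origin eq)
      ; nonempty = λ x → nonempty′ (vertex-cases x)
      ; connected = λ x eq eq′ → combined-connected x (origin eq) (origin eq′)
      ; edges = λ {x} {y} → combined-edges (vertex-cases x) (vertex-cases y)
      ; attached = λ x → attached′ (vertex-cases x)
      }
      where
      inside′ : ∀ {v x} → Origin v x → X v
      inside′ (from-apex y) = Y⊆X y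
      inside′ (from-copy i eq) = Z⊆X (M.inside i eq)
      nonempty′ : ∀ {x} → Vertex x → ∃ λ u → β′ u ≡ just x
      nonempty′ the-apex = a , β′-apex a∈Y
      nonempty′ (copy-of i x) with M.nonempty i x
      ... | u , eq = u , β′-copy i eq
      attached′ : ∀ {x} → Vertex x → ∀ {b} → b ∈ S → ∃ λ u → β′ u ≡ just x × Adj G b u
      attached′ the-apex b∈ with Ysees b∈
      ... | u , y , b~u = u , β′-apex y , b~u
      attached′ (copy-of i x) b∈ with M.attached i x (Any.there b∈)
      ... | u , eq , b~u = u , β′-copy i eq , b~u

  empty-model : ∀ {X S} → Model emptyGraph X S
  empty-model = record
    { β = λ _ → nothing ; inside = λ () ; nonempty = λ () ; connected = λ ()
    ; edges = λ { {()} } ; attached = λ () }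

  -- A (k + 1)-st branch is spent on connecting the apex to the vertices of S.
  rich⇒model : ∀ {k d} {t : ETree (V G) d} {S} s → Elimination t → Rich (suc k) t S s →
    Model C⟨ suc s , k ⟩ (_∈ₜ t) S
  -- `C⟨ 1 , k ⟩` is an apex over copies of the empty graph, so all of `t` forms the single branch
  -- set.
  rich⇒model {k} {t = t} {S} zero E r = apex-model {a = top t}
    (_∈ₜ t) (_∈ₜ? t) (Elimination.connected E) (at refl) (All.lookup r) (λ v∈ → v∈)
    (λ _ _ → ⊥) (λ _ _ → no λ ()) (λ ()) (λ _ ()) (λ ()) (λ _ → empty-model)
  rich⇒model {k} {S = S} (suc s) E r
    with _ , t₁ , E₁ , split , t₁⊆t , _ ← elimination-some E r
    with _ , t₂ , E₂ , (f , f-injective , rich) , t₂⊆t₁ , top∉ ← elimination-some E₁ split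
    = apex-model Y Y? Yconn (inj₁ refl) Ysees Y⊆t
        (λ i v → v ∈ₜ child t₂ (f (suc i))) (λ i v → v ∈ₜ? child t₂ (f (suc i)))
        (λ {i} v∈ → t₁⊆t (t₂⊆t₁ (below _ v∈)))
        Y∩Z
        (λ v∈ v∈′ → suc-injective (f-injective (Elimination.disjoint E₂ v∈ v∈′)))
        (λ i → rich⇒model s (Elimination.children E₂ (f (suc i))) (rich (suc i)))
    where
    t′ = child t₂ (f zero)
    a = top t₁
    Y : V G → Set
    Y v = v ≡ a ⊎ v ∈ₜ t′
    Y? : ∀ v → Dec (Y v)
    Y? v = (v ≟ a) ⊎-dec (v ∈ₜ? t′)
    touches : ∀ {b} → b ∈ a ∷ S → Touches t′ b
    touches b∈ = rich⇒touches s b∈ (rich zero)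
    from-a : ∀ {v} → v ∈ₜ t′ → Reach G Y a v
    from-a v∈ with touches (Any.here refl)
    ... | y , y∈ , a~y = step (inj₁ refl) a~y (reach-map inj₂ (Elimination.connected (Elimination.children E₂ (f zero)) y∈ v∈))
    Yconn : Connected {G} Y
    Yconn (inj₁ refl) (inj₁ refl) = here (inj₁ refl)
    Yconn (inj₁ refl) (inj₂ v∈) = from-a v∈
    Yconn (inj₂ u∈) (inj₁ refl) = reach-sym (from-a u∈)
    Yconn (inj₂ u∈) (inj₂ v∈) = reach-map inj₂ (Elimination.connected (Elimination.children E₂ (f zero)) u∈ v∈)
    Ysees : ∀ {b} → b ∈ S → ∃ λ u → Y u × Adj G b u
    Ysees b∈ with touches (Any.there b∈)
    ... | y , y∈ , b~y = y , inj₂ y∈ , b~y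
    Y⊆t : ∀ {v} → Y v → v ∈ₜ _
    Y⊆t (inj₁ refl) = t₁⊆t (at refl)
    Y⊆t (inj₂ v∈) = t₁⊆t (t₂⊆t₁ (below _ v∈))
    Y∩Z : ∀ {i v} → Y v → v ∈ₜ child t₂ (f (suc i)) → ⊥
    Y∩Z (inj₁ refl) v∈ = top∉ _ v∈
    Y∩Z (inj₂ v∈) v∈′ with f-injective (Elimination.disjoint E₂ v∈ v∈′)
    ... | ()

-- From treedepth to connected elimination trees.

depth-child : ∀ {m} (f : Fin m → ℕ) i → f i ≤ maxF m f
depth-child f zero = m≤m⊔n (f zero) _
depth-child f (suc i) = ≤-trans (depth-child (λ j → f (suc j)) i) (m≤n⊔m (f zero) _)

module _ {m : ℕ} {ch : Fin m → Tree} where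

  root? : (p : Pos (node m ch)) → Dec (p ≡ root)
  root? root = yes refl
  root? (sub _ _) = no λ ()

  slot : Pos (node m ch) → Maybe (Fin m)
  slot root = nothing
  slot (sub i _) = just i

  -- The value is the root, and meaningless, for positions outside the i-th subtree.
  descend : ∀ i → Pos (node m ch) → Pos (ch i)
  descend i root = root
  descend i (sub j q) with j ≟ i
  ... | yes refl = q
  ... | no _     = root

  sub-descend : ∀ {i} p → slot p ≡ just i → p ≡ sub i (descend i p)
  sub-descend {i} (sub .i q) refl with i ≟ i
  ... | yes refl = refl
  ... | no neq   = contradiction refl neq

  slot-adjacent : ∀ {p q : Pos (node m ch)} → p ≢ root → q ≢ root → ClosureAdj p q → slot p ≡ slot q
  slot-adjacent p≢ _ (inj₁ root≺) = contradiction refl p≢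
  slot-adjacent _ _ (inj₁ (sub≺ _)) = refl
  slot-adjacent _ q≢ (inj₂ root≺) = contradiction refl q≢
  slot-adjacent _ _ (inj₂ (sub≺ _)) = refl

  slot-nonroot : ∀ p → p ≢ root → ∃ λ i → slot p ≡ just i
  slot-nonroot root p≢ = contradiction refl p≢
  slot-nonroot (sub i _) _ = i , refl

  adjacent-sub : ∀ {i} {p q : Pos (ch i)} → ClosureAdj {node m ch} (sub i p) (sub i q) → ClosureAdj p q
  adjacent-sub (inj₁ (sub≺ l)) = inj₁ l
  adjacent-sub (inj₂ (sub≺ l)) = inj₂ l

module _ {G : Graph} where

  -- `place` is total but constrained only on `X`, so one map serves all subsets of `X`.
  record Placed (T : Tree) (X : V G → Set) : Set where
    field
      member?   : ∀ v → Dec (X v)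
      connected : Connected {G} X
      someone   : ∃ X
      place     : V G → Pos T
      injective : ∀ {u v} → X u → X v → place u ≡ place v → u ≡ v
      adjacent  : ∀ {u v} → X u → X v → Adj G u v → ClosureAdj (place u) (place v)

  -- Away from the root, adjacent positions lie below the same child, so connectedness forces all of
  -- `X` into one slot.
  placed-below : ∀ {m ch X} (L : Placed (node m ch) X) →
    (∀ {v} → X v → Placed.place L v ≢ root) → ∃ λ i → Placed (ch i) X
  placed-below {X = X} L nonroot with Placed.someone L
  ... | o , o∈ with slot-nonroot (Placed.place L o) (nonroot o∈)
  ...   | i , slot-o = i , record
    { member? = L.member? ; connected = L.connected ; someone = L.someone
    ; place = λ v → descend i (L.place v)
    ; injective = λ u∈ v∈ eq → L.injective u∈ v∈ (trans (place-sub u∈) (trans (cong (sub i) eq) (sym (place-sub v∈))))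
    ; adjacent = λ u∈ v∈ u~v → adjacent-sub (subst₂ ClosureAdj (place-sub u∈) (place-sub v∈) (L.adjacent u∈ v∈ u~v))
    }
    where
    module L = Placed L
    same-slot : ∀ {u v} → Reach G X u v → slot (L.place u) ≡ slot (L.place v)
    same-slot (here _) = refl
    same-slot (step u∈ u~v r) =
      trans (slot-adjacent (nonroot u∈) (nonroot (reach-source r)) (L.adjacent u∈ (reach-source r) u~v)) (same-slot r)
    place-sub : ∀ {v} → X v → L.place v ≡ sub i (descend i (L.place v))
    place-sub {v} v∈ = sub-descend (L.place v) (trans (same-slot (L.connected v∈ o∈)) slot-o)

  record EliminationTree (d : ℕ) (X : V G → Set) : Set where
    field
      tree        : ETree (V G) d
      elimination : Elimination G tree
      sound       : ∀ {v} → v ∈ₜ tree → X v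
      complete    : ∀ {v} → X v → v ∈ₜ tree

  -- Subtrees of `T` may be disconnected or have vacant roots, so the tree is rebuilt: the vertex
  -- `r` at the root is removed, and each component of the rest lies below one child of the root.
  elimination-tree : ∀ T d → depth T ≤ d → ∀ {X} → Placed T X → EliminationTree d X
  elimination-tree (node m ch) (suc d) (s≤s bound) {X} L
    with any? (λ v → Placed.member? L v ×-dec root? (Placed.place L v))
  ... | no none with placed-below L (λ v∈ eq → none (_ , v∈ , eq))
  -- A vacant root contributes no node, so the index stays `suc d`.
  ...   | i , L′ = elimination-tree (ch i) (suc d) (≤-trans (depth-child _ i) (≤-trans bound (n≤1+n d))) L′
  elimination-tree (node m ch) (suc d) (s≤s bound) {X} L | yes (r , r∈ , r-root) = record
    { tree = branch r (length reps) (λ j → E.tree j)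
    ; elimination = record
      { connected = λ u∈ v∈ → reach-map complete (L.connected (sound u∈) (sound v∈))
      ; top∉ = λ j r∈j → proj₂ (proj₁ (E.sound j r∈j)) refl
      ; disjoint = λ {i} {j} v∈i v∈j → rep-injective
          (trans (sym (proj₂ (E.sound i v∈i))) (proj₂ (E.sound j v∈j)))
      ; separated = λ {i} {j} u∈i v∈j u~v → rep-injective
          (trans (sym (proj₂ (E.sound i u∈i)))
            (trans (components-respect Y? (proj₁ (E.sound i u∈i)) (proj₁ (E.sound j v∈j)) u~v)
              (proj₂ (E.sound j v∈j))))
      ; children = λ j → E.elimination j
      }
    ; sound = sound
    ; complete = complete
    }
    where
    module L = Placed L
    Y : V G → Set
    Y v = X v × v ≢ r
    Y? : ∀ v → Dec (Y v)
    Y? v = L.member? v ×-dec ¬? (v ≟ r)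
    open Labelling (components {G} Y?)
    -- Vertices that are their own label index the components of `Y`, one each.
    Representative : V G → Set
    Representative v = Y v × label v ≡ v
    representative? : ∀ v → Dec (Representative v)
    representative? v = Y? v ×-dec (label v ≟ v)
    reps : List (V G)
    reps = witnesses representative?
    rep : Fin (length reps) → V G
    rep = lookup reps
    rep-injective : ∀ {i j} → rep i ≡ rep j → i ≡ j
    rep-injective = witness-injective representative?
    Part : Fin (length reps) → V G → Set
    Part j v = Y v × label v ≡ rep j
    part-connected : ∀ j → Connected {G} (Part j)
    part-connected j (u∈ , u-label) (v∈ , v-label) =
      within u-label (same-label⇒reach u∈ v∈ (trans u-label (sym v-label)))
      where
      within : ∀ {u v} → label u ≡ rep j → Reach G Y u v → Reach G (Part j) u v
      within eq (here u∈) = here (u∈ , eq)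
      within eq (step u∈ u~v p) = step (u∈ , eq) u~v
        (within (trans (sym (components-respect Y? u∈ (reach-source p) u~v)) eq) p)
    part-placed : ∀ j → Placed (node m ch) (Part j)
    part-placed j = record
      { member? = λ v → Y? v ×-dec (label v ≟ rep j)
      ; connected = part-connected j
      ; someone = rep j , witness-lookup representative? j
      ; place = L.place
      ; injective = λ u∈ v∈ → L.injective (proj₁ (proj₁ u∈)) (proj₁ (proj₁ v∈))
      ; adjacent = λ u∈ v∈ → L.adjacent (proj₁ (proj₁ u∈)) (proj₁ (proj₁ v∈))
      }
    part-tree : ∀ j → EliminationTree d (Part j)
    part-tree j with placed-below (part-placed j)
      (λ v∈ eq → proj₂ (proj₁ v∈) (L.injective (proj₁ (proj₁ v∈)) r∈ (trans eq (sym r-root))))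
    ... | i , L′ = elimination-tree (ch i) d (≤-trans (depth-child _ i) bound) L′
    module E j = EliminationTree (part-tree j)
    sound : ∀ {v} → v ∈ₜ branch r (length reps) (λ j → E.tree j) → X v
    sound (at refl) = r∈
    sound (below j v∈) = proj₁ (proj₁ (E.sound j v∈))
    complete : ∀ {v} → X v → v ∈ₜ branch r (length reps) (λ j → E.tree j)
    complete {v} v∈ with v ≟ r
    ... | yes refl = at refl
    ... | no v≢r = below (index rep∈) (E.complete _ ((v∈ , v≢r) , lookup-index rep∈))
      where
      rep∈ = ∈-witnesses representative? (label-∈ (v∈ , v≢r) , idempotent v)

-- Sublists, covers and the cluster bound.

sublists : ∀ {A : Set} → List A → List (List A)
sublists [] = [] ∷ []
sublists (x ∷ xs) = sublists xs ++ map (x ∷_) (sublists xs)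

length-sublists : ∀ {A : Set} (xs : List A) → length (sublists xs) ≡ 2 ^ length xs
length-sublists [] = refl
length-sublists (x ∷ xs) = trans (length-++ (sublists xs))
  (cong₂ _+_ (length-sublists xs)
    (trans (length-map (x ∷_) (sublists xs)) (trans (length-sublists xs) (sym (+-identityʳ _)))))

∈-sublists : ∀ {A : Set} {xs ys : List A} → xs ⊆ ys → xs ∈ sublists ys
∈-sublists [] = Any.here refl
∈-sublists (y ∷ʳ s) = ∈-++⁺ˡ (∈-sublists s)
∈-sublists (_∷_ {ys = ys} refl s) = ∈-++⁺ʳ (sublists ys) (∈-map⁺ _ (∈-sublists s))

Cover : ∀ {A : Set} → ℕ → (A → Set) → Set
Cover B P = Σ (List _) λ L → length L ≤ B × (∀ {v} → P v → v ∈ L)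

cover-union : ∀ {A I : Set} {B} {P : I → A → Set} (is : List I) → (∀ i → Cover B (P i)) →
  Cover (length is * B) (λ v → ∃ λ i → i ∈ is × P i v)
cover-union [] _ = [] , z≤n , λ ()
cover-union {P = P} (i ∷ is) covers with covers i | cover-union is covers
... | L , len , c | L′ , len′ , c′ = L ++ L′ , ≤-trans (≤-reflexive (length-++ L)) (+-mono-≤ len len′) , covered
  where
  covered : ∀ {v} → (∃ λ j → j ∈ i ∷ is × P j v) → v ∈ L ++ L′
  covered (_ , Any.here refl , p) = ∈-++⁺ˡ (c p)
  covered (j , Any.there j∈ , p) = ∈-++⁺ʳ L (c′ (j , j∈ , p))

-- Here `d` bounds the remaining depth and `l` is the number of proper ancestors. The outer `suc`
-- counts the top; `2 ^ suc l * K` bounds the light children, with `K` for each set of ancestors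
-- including the top. The inner `suc` makes the value dominate the bound for one child, whatever `K`
-- is.
clusterBound : ℕ → ℕ → ℕ → ℕ
clusterBound K zero    l = 0
clusterBound K (suc d) l = suc (suc (2 ^ suc l * K) * clusterBound K d (suc l))

-- Colouring an elimination tree chunk by chunk.

module _ (G : Graph) (k K : ℕ) where

  -- A proper ancestor together with its colour and the chunk that it belongs to; contexts list the
  -- ancestors from the nearest one upwards.
  record Entry : Set where
    constructor entry
    field
      vertex : V G
      colour : Fin k
      chunk  : V G
  open Entry

  vertices : List Entry → List (V G)
  vertices = map vertex

  colours : List Entry → List (Fin k)
  colours = map colour

  Context : Set
  Context = List Entry

  -- Without a minor, no rich subtree can see ancestors of pairwise different colours (all different
  -- from c) so that its depth and the number of ancestors add up to k.
  Poor : ∀ {d} → ETree (V G) d → Context → Set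
  Poor t Γ = ∀ S s → S ⊆ Γ → Unique (colours S) → Rich G K t (vertices S) s → length S + s ≡ k → ⊥

  -- The invariant once the top of `t` has colour `c`: only lists that this top could still extend
  -- to a rainbow list are excluded.
  PoorAvoiding : ∀ {d} → Fin k → ETree (V G) d → Context → Set
  PoorAvoiding c t Γ = ∀ S s → S ⊆ Γ → Unique (c ∷ colours S) → Rich G K t (vertices S) s → length S + s ≡ k → ⊥

  -- The entry `e` stands for `t₁` in the definition of `Rich`, chosen above or at the top of `t`,
  -- and the branching node `t₂` would lie in `t`.
  Unsplit : ∀ {d} → ETree (V G) d → Context → Set
  Unsplit t Γ = ∀ e S s → e ∷ S ⊆ Γ → Unique (colours (e ∷ S)) →
    Split G K t (vertices (e ∷ S)) s → length (e ∷ S) + s ≡ k → ⊥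

  module _ {d} {t : ETree (V G) d} {Γ : Context} {c : Fin k} {x : V G}
    (poor : PoorAvoiding c t Γ) (unsplit : Unsplit t Γ) where

    private
      Γ′ : Context
      Γ′ = entry (top t) c x ∷ Γ

    -- If `e` is the new entry, then `t` itself is the `t₁` that makes it rich for `S` at level
    -- `suc s`: one ancestor fewer, one level more, so the sum is still `k`.
    unsplit-extended : Unsplit t Γ′
    unsplit-extended e S s (_ ∷ʳ S⊆) u split eq = unsplit e S s S⊆ u split eq
    unsplit-extended e S s (refl ∷ S⊆) u split eq =
      poor S (suc s) S⊆ u (at split) (trans (+-suc (length S) s) eq)

    unsplit-child : ∀ i → Unsplit (child t i) Γ′
    unsplit-child i e S s S⊆ u split eq = unsplit-extended e S s S⊆ u (below i split) eq

    -- A list through the new entry would repeat the colour `c`.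
    poor-light : ∀ i → PoorAvoiding c (child t i) Γ′
    poor-light i S s (_ ∷ʳ S⊆) u r eq = poor S s S⊆ u (rich-child G s i r) eq
    poor-light i _ s (refl ∷ S⊆) ((c≢ ∷ _) ∷ _) r eq = c≢ refl

    -- Heaviness turns richness of one child into a split at `t`, which `unsplit-extended` excludes.
    -- The empty list has no ancestor to serve as `e`; there richness simply passes up to `t`.
    poor-heavy : ∀ i → (∀ {S} → S ∈ sublists Γ′ → Rich G K (child t i) (vertices S) (k ∸ length S) →
      Many K (λ j → Rich G K (child t j) (vertices S) (k ∸ length S))) → Poor (child t i) Γ′
    poor-heavy i heavy [] s _ _ r eq = poor [] s (minimum Γ) ([] ∷ []) (rich-child G s i r) eq
    poor-heavy i heavy (e ∷ S) s S⊆ u r eq = unsplit-extended e S s S⊆ u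
      (at (subst (λ z → Many K (λ j → Rich G K (child t j) (vertices (e ∷ S)) z)) (sym s≡)
        (heavy (∈-sublists S⊆) (subst (Rich G K (child t i) (vertices (e ∷ S))) s≡ r)))) eq
      where
      s≡ : s ≡ k ∸ length (e ∷ S)
      s≡ = trans (sym (m+n∸m≡n (length (e ∷ S)) s)) (cong (_∸ length (e ∷ S)) eq)

  open DecMembership (_≟_ {k}) using () renaming (_∈?_ to _∈ᶜ?_)

  rainbow : (P : V G → Set) → (∀ v → Dec (P v)) → ∀ Γ →
    Σ Context λ S → S ⊆ Γ × Unique (colours S) × All P (vertices S) ×
      (∀ {e} → e ∈ Γ → P (vertex e) → colour e ∈ colours S)
  rainbow P P? [] = [] , [] , [] , [] , λ ()
  rainbow P P? (e ∷ Γ) with rainbow P P? Γ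
  ... | S , S⊆ , u , all , seen with P? (vertex e) | colour e ∈ᶜ? colours S
  ...   | yes p | no new = e ∷ S , refl ∷ S⊆ , All.¬Any⇒All¬ _ new ∷ u , p ∷ all
                         , λ { (Any.here refl) _ → Any.here refl ; (Any.there e∈) p → Any.there (seen e∈ p) }
  ...   | yes p | yes old = S , e ∷ʳ S⊆ , u , all , λ { (Any.here refl) _ → old ; (Any.there e∈) p → seen e∈ p }
  ...   | no ¬p | _ = S , e ∷ʳ S⊆ , u , all , λ { (Any.here refl) p → contradiction p ¬p ; (Any.there e∈) p → seen e∈ p }

  -- If the ancestors seen by `t` had all `k` colours, a rainbow list of them would have length `k`.
  -- For `s = 0` richness only means touching the list, so this contradicts `Poor`.
  free-colour : ∀ {d} (t : ETree (V G) d) Γ → Poor t Γ →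
    ∃ λ c → ∀ {e} → e ∈ Γ → Touches G t (vertex e) → colour e ≢ c
  free-colour t Γ poor with rainbow (Touches G t) (touches? G t) Γ
  ... | S , S⊆ , u , all , seen with all? (λ c → c ∈ᶜ? colours S)
  ...   | no missing with ¬∀⟶∃¬ k _ (λ c → c ∈ᶜ? colours S) missing
  ...     | c , c∉ = c , λ { e∈ p refl → c∉ (seen e∈ p) }
  free-colour t Γ poor | S , S⊆ , u , all , seen | yes every =
    ⊥-elim (poor S 0 S⊆ u all (trans (+-identityʳ _) (trans (sym (length-map colour S))
      (≤-antisym (injective⇒≤ (unique-lookup-injective u))
        (injection-into-list {f = λ c → c} (λ eq → eq) (colours S) every)))))

  -- Chunks are named after their top vertices; `x` names the chunk containing the top of `t`, which
  -- may have begun above `t`. `small` counts only the part of a chunk inside `t`.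
  record Solution {d} (t : ETree (V G) d) (Γ : Context) (x : V G) : Set where
    field
      col   : V G → Fin k
      chunkOf : V G → V G
      inner : ∀ {u v} → u ∈ₜ t → v ∈ₜ t → Adj G u v → col u ≡ col v → chunkOf u ≡ chunkOf v
      outer : ∀ {e v} → e ∈ Γ → v ∈ₜ t → Adj G (vertex e) v → colour e ≡ col v → chunk e ≡ chunkOf v
      local : ∀ {v} → v ∈ₜ t → chunkOf v ≡ x ⊎ chunkOf v ∈ₜ t
      small : ∀ y → Cover (clusterBound K d (length Γ)) (λ v → v ∈ₜ t × chunkOf v ≡ y)

  -- By `valid`, ancestors seen by `t` may have colour `c` only within the chunk `x` being
  -- continued; `x∉` keeps `x` distinct from the names of chunks begun below.
  record Start {d} (t : ETree (V G) d) (Γ : Context) (c : Fin k) (x : V G) : Set where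
    field
      valid   : ∀ {e} → e ∈ Γ → Touches G t (vertex e) → colour e ≡ c → chunk e ≡ x
      x∉      : ∀ i → ¬ x ∈ₜ child t i
      poor    : PoorAvoiding c t Γ
      unsplit : Unsplit t Γ

  fresh-start : ∀ {d} {t : ETree (V G) d} {Γ} → Elimination G t → Poor t Γ → Unsplit t Γ →
    ∃ λ c → Start t Γ c (top t)
  fresh-start {t = t} {Γ} E poor unsplit with free-colour t Γ poor
  ... | c , free = c , record
    { valid = λ e∈ p eq → contradiction eq (free e∈ p)
    ; x∉ = Elimination.top∉ E
    ; poor = λ { S s S⊆ (_ ∷ u) → poor S s S⊆ u }
    ; unsplit = unsplit }

  module Combine {m d} {r : V G} {ch : Fin m → ETree (V G) d} {Γ : Context} {c : Fin k} {x : V G}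
    (E : Elimination G (branch r m ch)) (start : Start (branch r m ch) Γ c x)
    (light : List (Fin m)) (light-few : length light ≤ 2 ^ suc (length Γ) * K)
    (xs : Fin m → V G) (x-choice : ∀ i → (xs i ≡ x × i ∈ light) ⊎ xs i ∈ₜ ch i)
    (sol : ∀ i → Solution (ch i) (entry r c x ∷ Γ) (xs i)) where

    private
      t : ETree (V G) (suc d)
      t = branch r m ch
      module E = Elimination E
      module start = Start start
      module S i = Solution (sol i)

    pick : ∀ {A : Set} → A → (Fin m → V G → A) → V G → A
    pick a f v with any? (λ i → _∈ₜ?_ G v (ch i))
    ... | yes (i , _) = f i v
    ... | no _        = a

    pick-top : ∀ {A : Set} {a : A} {f} → pick a f r ≡ a
    pick-top with any? (λ i → _∈ₜ?_ G r (ch i))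
    ... | yes (i , r∈) = contradiction r∈ (E.top∉ i)
    ... | no _ = refl

    pick-child : ∀ {A : Set} {a : A} {f} {i v} → v ∈ₜ ch i → pick a f v ≡ f i v
    pick-child {i = i} {v} v∈ with any? (λ i → _∈ₜ?_ G v (ch i))
    ... | no ∄ = contradiction (i , v∈) ∄
    ... | yes (j , v∈′) with E.disjoint v∈′ v∈
    ...   | refl = refl

    col : V G → Fin k
    col = pick c S.col

    chunkOf : V G → V G
    chunkOf = pick x S.chunkOf

    x∉ : ∀ i → ¬ x ∈ₜ ch i
    x∉ = start.x∉

    -- The name `x` enters a child only if it is light; every other name occurring there is a vertex
    -- of that child.
    chunk-in-child : ∀ {i v} → v ∈ₜ ch i → (S.chunkOf i v ≡ x × i ∈ light) ⊎ S.chunkOf i v ∈ₜ ch i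
    chunk-in-child {i} v∈ with S.local i v∈ | x-choice i
    ... | inj₂ y∈ | _ = inj₂ y∈
    ... | inj₁ eq | inj₁ (eq′ , i∈) = inj₁ (trans eq eq′ , i∈)
    ... | inj₁ eq | inj₂ xᵢ∈ = inj₂ (subst (_∈ₜ ch i) (sym eq) xᵢ∈)

    top-edge : ∀ {i v} → v ∈ₜ ch i → Adj G r v → c ≡ S.col i v → x ≡ S.chunkOf i v
    top-edge {i} v∈ r~v eq = S.outer i (Any.here refl) v∈ r~v eq

    inner : ∀ {u v} → u ∈ₜ t → v ∈ₜ t → Adj G u v → col u ≡ col v → chunkOf u ≡ chunkOf v
    inner (at refl) (at refl) _ _ = refl
    inner (at refl) (below i v∈) u~v eq = trans pick-top (trans
      (top-edge v∈ u~v (trans (sym pick-top) (trans eq (pick-child v∈)))) (sym (pick-child v∈)))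
    inner (below i u∈) (at refl) u~v eq = trans (pick-child u∈) (trans
      (sym (top-edge u∈ (adj-sym {G} u~v) (trans (sym pick-top) (trans (sym eq) (pick-child u∈))))) (sym pick-top))
    inner (below i u∈) (below j v∈) u~v eq with E.separated u∈ v∈ u~v
    ... | refl = trans (pick-child u∈) (trans
      (S.inner i u∈ v∈ u~v (trans (sym (pick-child u∈)) (trans eq (pick-child v∈)))) (sym (pick-child v∈)))

    outer : ∀ {e v} → e ∈ Γ → v ∈ₜ t → Adj G (vertex e) v → colour e ≡ col v → chunk e ≡ chunkOf v
    outer e∈ (at refl) e~v eq =
      trans (start.valid e∈ (r , at refl , e~v) (trans eq pick-top)) (sym pick-top)
    outer e∈ (below i v∈) e~v eq =
      trans (S.outer i (Any.there e∈) v∈ e~v (trans eq (pick-child v∈))) (sym (pick-child v∈))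

    local : ∀ {v} → v ∈ₜ t → chunkOf v ≡ x ⊎ chunkOf v ∈ₜ t
    local (at refl) = inj₁ pick-top
    local (below i v∈) with chunk-in-child v∈
    ... | inj₁ (eq , _) = inj₁ (trans (pick-child v∈) eq)
    ... | inj₂ y∈ = inj₂ (subst (_∈ₜ t) (sym (pick-child v∈)) (below i y∈))

    bound : ℕ
    bound = clusterBound K d (suc (length Γ))

    small-own : Cover (suc (suc (2 ^ suc (length Γ) * K) * bound)) (λ v → v ∈ₜ t × chunkOf v ≡ x)
    -- The chunk `x` consists of `r` and its shares in the light children.
    small-own with cover-union light (λ i → S.small i x)
    ... | L , len , covered =
      r ∷ L , s≤s (≤-trans len (*-monoˡ-≤ bound (≤-trans light-few (n≤1+n _)))) , λ { (v∈ , eq) → covers v∈ eq }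
      where
      covers : ∀ {v} → v ∈ₜ t → chunkOf v ≡ x → v ∈ r ∷ L
      covers (at refl) _ = Any.here refl
      covers (below i v∈) eq with chunk-in-child v∈ | trans (sym (pick-child v∈)) eq
      ... | inj₁ (_ , i∈) | eq′ = Any.there (covered (i , i∈ , v∈ , eq′))
      ... | inj₂ y∈ | eq′ = contradiction (subst (_∈ₜ ch i) eq′ y∈) (x∉ i)

    -- A chunk not named `x` is named by a vertex of one child, which therefore contains all of its
    -- part in `t`.
    confined : ∀ {v y} → y ≢ x → v ∈ₜ t → chunkOf v ≡ y →
      ∃ λ i → y ∈ₜ ch i × v ∈ₜ ch i × S.chunkOf i v ≡ y
    confined y≢ (at refl) eq = contradiction (trans (sym eq) pick-top) y≢
    confined y≢ (below i v∈) eq with chunk-in-child v∈ | trans (sym (pick-child v∈)) eq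
    ... | inj₁ (eq′ , _) | refl = contradiction eq′ y≢
    ... | inj₂ y∈ | refl = i , y∈ , v∈ , refl

    fits : bound ≤ suc (suc (2 ^ suc (length Γ) * K) * bound)
    fits = ≤-trans (m≤m+n bound _) (n≤1+n _)

    small-other : ∀ {y} → y ≢ x → Cover (suc (suc (2 ^ suc (length Γ) * K) * bound)) (λ v → v ∈ₜ t × chunkOf v ≡ y)
    small-other {y} y≢ with any? (λ i → _∈ₜ?_ G y (ch i))
    ... | no ∄ = [] , z≤n , λ { (v∈ , eq) → let i , y∈ , _ = confined y≢ v∈ eq in contradiction (i , y∈) ∄ }
    ... | yes (i , y∈) with S.small i y
    ...   | L , len , covered = L , ≤-trans len fits , λ { (v∈ , eq) → covers (confined y≢ v∈ eq) }
      where
      covers : ∀ {v} → (∃ λ j → y ∈ₜ ch j × v ∈ₜ ch j × S.chunkOf j v ≡ y) → v ∈ L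
      covers (j , y∈′ , v∈ , eq) with E.disjoint y∈ y∈′
      ... | refl = covered (v∈ , eq)

    small : ∀ y → Cover (clusterBound K (suc d) (length Γ)) (λ v → v ∈ₜ t × chunkOf v ≡ y)
    small y with y ≟ x
    ... | yes refl = small-own
    ... | no y≢x = small-other y≢x

    solution : Solution t Γ x
    solution = record
      { col = col ; chunkOf = chunkOf ; inner = inner ; outer = outer ; local = local ; small = small }

  solve : ∀ {d} (t : ETree (V G) d) {Γ c x} → Elimination G t → Start t Γ c x → Solution t Γ x
  solve t@(branch r m ch) {Γ} {c} {x} E start = combined
    where
    open Start start
    Γ′ : Context
    Γ′ = entry r c x ∷ Γ
    -- The equation `length S + s ≡ k` determines `s`, so one richness condition per sublist
    -- suffices.
    R : Context → Fin m → Set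
    R S i = Rich G K (ch i) (vertices S) (k ∸ length S)
    classified = light-or-heavy K R (λ S i → rich? G K (ch i) (vertices S) (k ∸ length S)) (sublists Γ′)
    light : List (Fin m)
    light = proj₁ classified
    light-start : ∀ i → Start (ch i) Γ′ c x
    light-start i = record
      { valid = λ { (Any.here refl) _ _ → refl ; (Any.there e∈) p → valid e∈ (touches-child G {t = t} i p) }
      ; x∉ = λ j x∈ → x∉ i (below j x∈)
      ; poor = poor-light {t = t} poor unsplit i
      ; unsplit = unsplit-child {t = t} poor unsplit i
      }
    child-solution : ∀ i → Σ (V G) λ y → ((y ≡ x × i ∈ light) ⊎ y ∈ₜ ch i) × Solution (ch i) Γ′ y
    child-solution i with proj₂ (proj₂ classified) i
    -- A light child continues the chunk `x` in colour `c`; a heavy child starts a new chunk in a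
    -- free colour.
    ... | inj₁ i∈ = x , inj₁ (refl , i∈) , solve (ch i) (Elimination.children E i) (light-start i)
    ... | inj₂ heavy with fresh-start (Elimination.children E i)
                            (poor-heavy {t = t} poor unsplit i heavy) (unsplit-child {t = t} poor unsplit i)
    ...   | c′ , start′ = top (ch i) , inj₂ (at refl) , solve (ch i) (Elimination.children E i) start′
    combined : Solution t Γ x
    combined = Combine.solution E start light
      (≤-trans (proj₁ (proj₂ classified)) (*-monoˡ-≤ K (≤-reflexive (length-sublists Γ′))))
      (λ i → proj₁ (child-solution i)) (λ i → proj₁ (proj₂ (child-solution i)))
      (λ i → proj₂ (proj₂ (child-solution i)))

-- Clustered colouring of a graph of bounded treedepth.

module _ {G : Graph} {D : ℕ} (treedepth : Treedepth≤ G D) where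

  private
    All? : ∀ (v : V G) → Dec ⊤
    All? _ = yes tt

  open Labelling (components {G} All?)

  Component : V G → V G → Set
  Component x w = label w ≡ label x

  component-placed : ∀ x → Placed {G} (proj₁ (treedepth x)) (Component x)
  component-placed x with treedepth x
  ... | T , _ , f , f-injective , f-adjacent = record
    { member? = λ w → label w ≟ label x
    ; connected = λ u∈ v∈ → within u∈ (same-label⇒reach tt tt (trans u∈ (sym v∈)))
    ; someone = x , refl
    ; place = place
    ; injective = λ u∈ v∈ eq → place-injective (place-image u∈) (place-image v∈) eq
    ; adjacent = λ u∈ v∈ u~v → place-adjacent (place-image u∈) (place-image v∈) u~v
    }
    where
    within : ∀ {u v} → Component x u → Reach G (λ _ → ⊤) u v → Reach G (Component x) u v
    within u∈ (here _) = here u∈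
    within u∈ (step _ u~v r) = step u∈ u~v (within (trans (sym (components-respect All? tt tt u~v)) u∈) r)
    place : V G → Pos T
    place w with label w ≟ label x
    ... | yes eq = f (w , same-label⇒reach tt tt (sym eq))
    -- An arbitrary value outside the component.
    ... | no _   = root
    place-image : ∀ {w} → Component x w → ∃ λ r → place w ≡ f (w , r)
    place-image {w} w∈ with label w ≟ label x
    ... | yes eq = _ , refl
    ... | no neq = contradiction w∈ neq
    place-injective : ∀ {u v} → (∃ λ r → place u ≡ f (u , r)) → (∃ λ r → place v ≡ f (v , r)) →
      place u ≡ place v → u ≡ v
    place-injective (_ , eq) (_ , eq′) e = f-injective _ _ (trans (sym eq) (trans e eq′))
    place-adjacent : ∀ {u v} → (∃ λ r → place u ≡ f (u , r)) → (∃ λ r → place v ≡ f (v , r)) →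
      Adj G u v → ClosureAdj (place u) (place v)
    place-adjacent (_ , eq) (_ , eq′) u~v = subst₂ ClosureAdj (sym eq) (sym eq′) (f-adjacent _ _ u~v)

  component-tree : ∀ x → EliminationTree {G} D (Component x)
  component-tree x = elimination-tree _ D (proj₁ (proj₂ (treedepth x))) (component-placed x)

  clustered-colouring : ∀ k b → ¬ Minor C⟨ suc k , b ⟩ G →
    Σ (Colouring G k) λ col → HasClustering G col (clusterBound (suc b) D 0)
  clustered-colouring k b no-minor = col , clustering
    where
    module T x = EliminationTree (component-tree x)
    component-solution : ∀ x → ∃ λ y → Solution G k (suc b) (T.tree x) [] y
    component-solution x
      with fresh-start G k (suc b) {t = T.tree x} {Γ = []} (T.elimination x)
             -- Without ancestors only `S = []` and `s = k` remain, and richness then yields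
             -- `C⟨ suc k , b ⟩`, with `K = suc b` leaving one spare branch.
             (λ { _ s [] _ rich refl → no-minor (model⇒minor G (rich⇒model G s (T.elimination x) rich)) })
             (λ _ _ _ ())
    ... | c , start = _ , solve G k (suc b) (T.tree x) (T.elimination x) start
    module S x = Solution (proj₂ (component-solution x))
    col : V G → Fin k
    -- Using the solution at `label v` makes all vertices of a component share one solution.
    col v = S.col (label v) v
    own : ∀ {v w} → label w ≡ label v → w ∈ₜ T.tree (label v)
    own {v} eq = T.complete (label v) (trans eq (sym (idempotent v)))
    same-chunk : ∀ {v w c} → Reach G (λ u → col u ≡ c) v w →
      label v ≡ label w × S.chunkOf (label v) w ≡ S.chunkOf (label v) v
    same-chunk (here _) = refl , refl
    same-chunk {v} (step {v = u} v-colour v~u r) with same-chunk r | components-respect All? {v} {u} tt tt v~u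
    ... | eq , chunk | eq′ = trans eq′ eq , trans
      (subst (λ l → S.chunkOf l _ ≡ S.chunkOf l u) (sym eq′) chunk)
      (sym (S.inner (label v) (own refl) (own (sym eq′)) v~u
        (trans v-colour (trans (sym (reach-source r)) (cong (λ l → S.col l u) (sym eq′))))))
    clustering : HasClustering G col (clusterBound (suc b) D 0)
    clustering v (f , f-injective , reach) with S.small (label v) (S.chunkOf (label v) v)
    ... | L , len , covered = <⇒≱ (s≤s len) (injection-into-list f-injective L λ i →
      let eq , chunk = same-chunk (reach i) in covered (own (sym eq) , chunk))

-- Lower bound on the defective chromatic number.

clustering⇒defect : ∀ {G k c} {col : Colouring G k} → HasClustering G col c → HasDefect G col c
clustering⇒defect {G} clustering v (f , f-injective , near) = clustering v
  (f , f-injective , λ i → step refl (proj₁ (near i)) (here (proj₂ (near i))))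

crowded-or-rainbow : ∀ {J k} h (φ : V C⟨ h , k ⟩ → Fin J) →
  (∃ λ v → Many k (λ w → Adj C⟨ h , k ⟩ v w × φ w ≡ φ v)) ⊎
  (Σ (Fin h → V C⟨ h , k ⟩) λ g → Injective _≡_ _≡_ (λ i → φ (g i)))
crowded-or-rainbow zero φ = inj₂ ((λ ()) , λ { {()} })
crowded-or-rainbow {k = k} (suc h) φ
  with all? (λ i → any? (λ x → φ (suc (combine {k} {n C⟨ h , k ⟩} i x)) ≟ φ zero))
-- The root is adjacent to everything below it, so one vertex of its colour per copy gives `k`
-- neighbours.
... | yes every = inj₁ (zero
  , (λ i → suc (combine i (proj₁ (every i))))
  , (λ {i} {j} eq → proj₁ (combine-injective i (proj₁ (every i)) j (proj₁ (every j)) (suc-injective eq)))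
  , (λ i → refl , proj₂ (every i)))
... | no ¬every with ¬∀⟶∃¬ k _ (λ i → any? (λ x → φ (suc (combine {k} {n C⟨ h , k ⟩} i x)) ≟ φ zero)) ¬every
...   | i , avoids with crowded-or-rainbow {k = k} h (λ x → φ (suc (combine i x)))
...     | inj₁ (v , f , f-injective , near) = inj₁ (suc (combine i v) , (λ j → suc (combine i (f j)))
  , (λ {j} {j′} eq → f-injective (proj₂ (combine-injective i (f j) i (f j′) (suc-injective eq))))
  , (λ j → copies-adjacent⁺ {k} {C⟨ h , k ⟩} i (proj₁ (near j)) , proj₂ (near j)))
...     | inj₂ (g , g-injective) = inj₂ (g′ , g′-injective)
  where
  g′ : Fin (suc h) → V C⟨ suc h , k ⟩
  g′ zero = zero
  g′ (suc j) = suc (combine i (g j))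
  g′-injective : Injective _≡_ _≡_ (λ j → φ (g′ j))
  g′-injective {zero} {zero} _ = refl
  g′-injective {zero} {suc j} eq = contradiction (g j , sym eq) avoids
  g′-injective {suc j} {zero} eq = contradiction (g j , eq) avoids
  g′-injective {suc j} {suc j′} eq = cong suc (g-injective eq)

-- Arity `suc d` is chosen because a crowd of `suc d` neighbours is exactly what defect `d` forbids.
defective⇒height≤ : ∀ {J d} h (col : Colouring C⟨ h , suc d ⟩ J) → HasDefect C⟨ h , suc d ⟩ col d → h ≤ J
defective⇒height≤ {d = d} h col defect with crowded-or-rainbow {k = suc d} h col
... | inj₁ (v , crowd) = contradiction crowd (defect v)
... | inj₂ (_ , injective) = injective⇒≤ injective

-- Cliques and treedepth.

level : ∀ {t} → Pos t → ℕ
level root = 0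
level (sub i p) = suc (level p)

level<depth : ∀ {t} (p : Pos t) → level p < depth t
level<depth {node m ch} root = s≤s z≤n
level<depth {node m ch} (sub i p) = s≤s (≤-trans (level<depth p) (depth-child _ i))

≺⇒level< : ∀ {t} {p q : Pos t} → p ≺ q → level p < level q
≺⇒level< root≺ = s≤s z≤n
≺⇒level< (sub≺ l) = s≤s (≺⇒level< l)

level-distinguishes : ∀ {t} {p q : Pos t} → ClosureAdj p q → level p ≢ level q
level-distinguishes (inj₁ l) eq = <⇒≱ (≺⇒level< l) (≤-reflexive (sym eq))
level-distinguishes (inj₂ l) eq = <⇒≱ (≺⇒level< l) (≤-reflexive eq)

clique-size : ∀ h → n C⟨ h , 1 ⟩ ≡ h
clique-size zero = refl
clique-size (suc h) = cong suc (trans (*-identityˡ _) (clique-size h))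

clique-adjacent : ∀ h {u v : V C⟨ h , 1 ⟩} → u ≢ v → Adj C⟨ h , 1 ⟩ u v
clique-adjacent (suc h) {zero} {zero} neq = contradiction refl neq
clique-adjacent (suc h) {zero} {suc _} _ = refl
clique-adjacent (suc h) {suc _} {zero} _ = refl
clique-adjacent (suc h) {suc u} {suc v} neq
  with copies-vertex {1} {C⟨ h , 1 ⟩} u | copies-vertex {1} {C⟨ h , 1 ⟩} v
... | copy-vertex zero x | copy-vertex zero y =
  copies-adjacent⁺ {1} {C⟨ h , 1 ⟩} zero (clique-adjacent h (λ eq → neq (cong (λ z → suc (combine {1} zero z)) eq)))

-- Positions adjacent in a closure have different levels, so the level is injective on a clique.
clique-treedepth : ∀ h {c} → Treedepth≤ C⟨ suc h , 1 ⟩ c → suc h ≤ c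
clique-treedepth h {c} treedepth with treedepth zero
... | T , depth≤ , f , _ , f-adjacent =
  ≤-trans (subst (_≤ depth T) (clique-size (suc h)) (injective⇒≤ rank-injective)) depth≤
  where
  K : Graph
  K = C⟨ suc h , 1 ⟩
  reachable : ∀ w → Reach K (λ _ → ⊤) zero w
  reachable zero = here tt
  reachable (suc w) = step tt refl (here tt)
  place : V K → Pos T
  place w = f (w , reachable w)
  rank : V K → Fin (depth T)
  rank w = fromℕ< (level<depth (place w))
  rank-injective : Injective _≡_ _≡_ rank
  rank-injective {u} {v} eq with u ≟ v
  ... | yes u≡v = u≡v
  ... | no u≢v = contradiction (fromℕ<-injective _ _ _ _ eq)
    (level-distinguishes (f-adjacent (u , reachable u) (v , reachable v) (clique-adjacent (suc h) u≢v)))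

-- Existence of the tree-closure-number, and the conclusion.

-- `P` is not assumed decidable, hence the double negation.
¬¬-minimum : ∀ {P : ℕ → Set} m → P m → ¬ ¬ Σ ℕ (IsMinimum P)
¬¬-minimum {P} = <-rec _ λ m smaller p none → none (m , p , λ j q →
  decidable-stable (m ≤? j) λ m≰j → smaller (≰⇒> m≰j) q none)

theorem1 : (𝒢 : GraphClass) → MinorClosed 𝒢 → BoundedTreedepth 𝒢 →
    (¬ ¬ Σ ℕ (TcnIs 𝒢))
    × (∀ t → TcnIs 𝒢 t →
    DefectiveChromaticNumberIs 𝒢 (t ∸ 1) × ClusteredChromaticNumberIs 𝒢 (t ∸ 1))
theorem1 𝒢 minor-closed (D , treedepth) = tcn-exists , λ { t tcn → chromatic-numbers t tcn }
  where
  tcn-exists : ¬ ¬ Σ ℕ (TcnIs 𝒢)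
  -- `C⟨ suc D , 1 ⟩` is a clique on `suc D` vertices, too large for treedepth `D`.
  tcn-exists = ¬¬-minimum (suc D) (s≤s z≤n , 1 , s≤s z≤n ,
    λ K∈ → <⇒≱ (clique-treedepth D (treedepth _ K∈)) ≤-refl)

  lower : ∀ {h} → (∀ j → TcnCandidate 𝒢 j → suc h ≤ j) → ∀ j → DefectivelyColourable 𝒢 j → h ≤ j
  lower {zero} _ _ _ = z≤n
  -- If `suc h ≤ j` failed, `C⟨ suc h , suc d ⟩` could not lie in the class, and `suc h` would be a
  -- candidate below the minimum.
  lower {suc h} least j (d , colourable) = decidable-stable (suc h ≤? j) λ h≰j →
    <⇒≱ (least (suc h) (s≤s z≤n , suc d , s≤s z≤n , λ C∈ →
      h≰j (let col , defect = colourable _ C∈ in defective⇒height≤ (suc h) col defect))) ≤-refl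

  defective : ∀ {j} → ClusteredColourable 𝒢 j → DefectivelyColourable 𝒢 j
  defective (c , colourable) = c , λ G G∈ →
    let col , clustering = colourable G G∈ in col , clustering⇒defect {G} {col = col} clustering

  chromatic-numbers : ∀ t → TcnIs 𝒢 t →
    DefectiveChromaticNumberIs 𝒢 (t ∸ 1) × ClusteredChromaticNumberIs 𝒢 (t ∸ 1)
  chromatic-numbers (suc h) ((_ , b , _ , C∉) , least) =
    (defective clustered , lower least) , clustered , λ j c → lower least j (defective c)
    where
    clustered : ClusteredColourable 𝒢 h
    clustered = clusterBound (suc b) D 0 , λ G G∈ →
      clustered-colouring (treedepth G G∈) h b (λ minor → C∉ (minor-closed G _ G∈ minor))
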